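{- Let $n\ge 2$ and $1\le a\le 2n-2$ be integers, and let $\mathcal{Z}=T_a=\{(x,y)\in\mathbb{Z}_+^2\colon x+y\le a-1\}$. If $a$ is even, then $$\gamma(\mathcal{Z},n,n)=\frac{an}{2}.$$ If $a$ is odd and $a\le n$, then $$\gamma(\mathcal{Z},n,n)=\frac{a+1}{2}\,n-\frac{a-1}{2}.$$ If $a$ is odd and $a>n$, then $$\gamma(\mathcal{Z},n,n)=\frac{a-1}{2}\,n+\left\lceil\frac{n(2n-a+1)}{2(2n-a)}\right\rceil.$$
   Context: $\mathbb{Z}_+=\{0,1,2,\dots\}$, $\mathbb{N}=\{1,2,\dots\}$, $[0,c]=\{0,1,\dots,c\}$, and $R_{a,b}=[0,a-1]\times[0,b-1]$. A zero-set (Young diagram) is a downward-closed set $\mathcal{Z}\subseteq\mathbb{Z}_+^2$. For $m,n\in\mathbb{N}$, the graph $K_m\Box K_n$ is represented on the vertex set $R_{n,m}=[0,n-1]\times[0,m-1]$, with two vertices adjacent iff they differ in exactly one coordinate. For $v=(j,i)\in R_{n,m}$, the row neighborhood $\mathcal{N}^r(v)$ is the set of all $(j',i)\in R_{n,m}$ with $j'\neq j$, and the column neighborhood $\mathcal{N}^c(v)$ is the set of all $(j,i')\in R_{n,m}$ with $i'\ne i$. Given $\mathcal{Z}$, for $A\subseteq R_{n,m}$ let $\mathcal{T}(A)=A\cup\{v\in R_{n,m}\setminus A\colon (|\mathcal{N}^r(v)\cap A|,|\mathcal{N}^c(v)\cap A|)\notin\mathcal{Z}\}$. Then $\gamma(\mathcal{Z},m,n)=\min\{|A|\colon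 A\subseteq R_{n,m},\ \mathcal{T}(A)=R_{n,m}\}$. (Thus $\gamma(T_a,n,n)$ is the $a$-domination number of $K_n\Box K_n$: the minimum size of a vertex set $D$ such that each vertex outside $D$ has at least $a$ neighbors in $D$.) -}

module Defs where

import Algebra.Properties.CommutativeMonoid.Sum
open import Data.Bool.Base using (Bool; true; if_then_else_; _∧_)
open import Data.Fin.Base using (Fin)
open import Data.Fin.Properties using (_≟_)
open import Data.Nat.Base
  using (ℕ; _+_; _*_; _∸_; _/_; _≤_; _<_; s≤s; z≤n; NonZero; >-nonZero)
open import Data.Nat.Properties
  using (+-0-commutativeMonoid; +-mono-≤; ≤-trans; ≤-<-trans; m≤n*m; m<n⇒0<n∸m;
         m*n≢0; ∸-monoʳ-<)
open import Data.Product.Base using (∃; _×_; _,_)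
open import Level using (0ℓ)
open import Relation.Binary.PropositionalEquality using (_≡_)
open import Relation.Nullary.Decidable using (does; ¬?)
open import Relation.Unary using (Pred; _∈_; _∉_; _∪_; _∩_; ∁; Universal)

open Algebra.Properties.CommutativeMonoid.Sum +-0-commutativeMonoid using (sum)

record ZeroSet : Set₁ where
  field
    points     : Pred (ℕ × ℕ) 0ℓ
    downClosed : ∀ {x y x′ y′} → x′ ≤ x → y′ ≤ y →
                 (x , y) ∈ points → (x′ , y′) ∈ points

open ZeroSet public

-- The index is meant to be positive: the truncated subtraction makes
-- T 0 coincide with T 1.
T : ℕ → ZeroSet
T a = record
  { points     = λ (x , y) → x + y ≤ a ∸ 1
  ; downClosed = λ x′≤x y′≤y x+y≤ → ≤-trans (+-mono-≤ x′≤x y′≤y) x+y≤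
  }

-- R n m = [0,n-1] × [0,m-1], the vertex set of K_m □ K_n.
R : ℕ → ℕ → Set
R n m = Fin n × Fin m

-- Subsets of R n m are given by characteristic functions, so that they can
-- be counted.
VertexSet : ℕ → ℕ → Set
VertexSet n m = R n m → Bool

⟪_⟫ : ∀ {n m} → VertexSet n m → Pred (R n m) 0ℓ
⟪ A ⟫ v = A v ≡ true

∣_∣ : ∀ {n m} → VertexSet n m → ℕ
∣_∣ {n} {m} A =
  sum {n} λ j → sum {m} λ i → if A (j , i) then 1 else 0

infixr 7 _⊓_

_⊓_ : ∀ {n m} → VertexSet n m → VertexSet n m → VertexSet n m
(A ⊓ B) v = A v ∧ B v

𝒩ʳ : ∀ {n m} → R n m → VertexSet n m
𝒩ʳ (j , i) (j′ , i′) = does (¬? (j′ ≟ j)) ∧ does (i′ ≟ i)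

𝒩ᶜ : ∀ {n m} → R n m → VertexSet n m
𝒩ᶜ (j , i) (j′ , i′) = does (j′ ≟ j) ∧ does (¬? (i′ ≟ i))

-- The image is a predicate rather than a characteristic function because
-- membership in an arbitrary zero-set need not be decidable.
𝒯 : ∀ {n m} → ZeroSet → VertexSet n m → Pred (R n m) 0ℓ
𝒯 Z A = ⟪ A ⟫ ∪ (∁ ⟪ A ⟫ ∩ λ v → (∣ 𝒩ʳ v ⊓ A ∣ , ∣ 𝒩ᶜ v ⊓ A ∣) ∉ points Z)

IsMinimum : Pred ℕ 0ℓ → Pred ℕ 0ℓ
IsMinimum P k = k ∈ P × (∀ l → l ∈ P → k ≤ l)

SpanningSize : ZeroSet → ℕ → ℕ → Pred ℕ 0ℓ
SpanningSize Z m n k =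
  ∃ λ (A : VertexSet n m) → Universal (𝒯 Z A) × ∣ A ∣ ≡ k

-- Isγ Z m n k says that the minimum defining γ(Z,m,n) exists and equals k.
-- The minimum is a relation because computing it would require Z to be
-- decidable.
Isγ : ZeroSet → ℕ → ℕ → ℕ → Set
Isγ Z m n = IsMinimum (SpanningSize Z m n)

⌈_/_⌉ : (x d : ℕ) .{{_ : NonZero d}} → ℕ
⌈ x / d ⌉ = (x + (d ∸ 1)) / d

-- Only serves to supply the instance argument of the division.
denominator≢0 : ∀ {n a} → 2 ≤ n → a ≤ 2 * n ∸ 2 → NonZero (2 * (2 * n ∸ a))
denominator≢0 {n} {a} 2≤n a≤2n-2 =
  m*n≢0 2 (2 * n ∸ a) {{_}} {{>-nonZero (m<n⇒0<n∸m a<2n)}}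
  where
  a<2n : a < 2 * n
  a<2n = ≤-<-trans a≤2n-2
           (∸-monoʳ-< {2 * n} {2} {0} (s≤s z≤n) (≤-trans 2≤n (m≤n*m n 2)))

{-# OPTIONS --safe #-}
module Submission where

-- A set is dominating when r i + c j ≥ a for every vertex (j , i) outside it, r and c being
-- its row and column counts. Summing this over those vertices gives
-- 2ns − Σ r² − Σ c² ≥ a(n² − s) for a set of size s. With a = b + b′ and b ≤ b′ ≤ b + 1,
-- integrality gives r² ≥ (b + b′)r − bb′; what results is the lower bound for even a and for
-- odd a > n. For odd a = 2b + 1 ≤ n, a smallest line with r ≤ b vertices forces at least
-- (n − r)(a − r) + r² ≥ (b + 1)n − b vertices.
--
-- For even a a cyclic set with a/2 vertices in every line is optimal. For a = 2b + 1 take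
-- t lines of size b + 1 and n − t lines of size b in both directions, where the light
-- lines meet in vertices of the set only: with k = n − b this is possible as soon as t ≥ k and
-- nk ≤ t(2k − 1), and the least such t attains the bound.

open import Defs
open import Data.Nat.Base using (ℕ; _+_; _*_; _∸_; _/_; _≤_; _<_)
open import Data.Nat.Divisibility using (_∣_; _∤_)
open import Data.Product.Base using (_×_)

import Algebra.Properties.CommutativeMonoid.Sum
import Algebra.Properties.Semiring.Sum
open import Data.Bool.Base using (Bool; true; false; if_then_else_; _∧_)
open import Data.Fin.Base using (Fin; zero; suc; toℕ; fromℕ; inject₁; splitAt; _↑ˡ_; _↑ʳ_)
open import Data.Fin.Properties
  using (_≟_; any?; suc-injective; toℕ<n; toℕ-inject₁; toℕ-fromℕ;
         splitAt-↑ˡ; splitAt-↑ʳ)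
open import Data.Nat.Base
  using (zero; suc; z≤n; s≤s; _%_; _<ᵇ_; NonZero)
open import Data.Nat.Divisibility using (divides-refl; ∣-refl; ∣m∣n⇒∣m+n)
open import Data.Nat.DivMod
open import Data.Nat.Properties hiding (_≟_; suc-injective)
open import Data.Nat.Tactic.RingSolver using (solve-∀)
open import Data.Product.Base using (∃; ∃-syntax; _,_; swap)
open import Data.Sum.Base using (_⊎_; inj₁; inj₂; [_,_]′)
open import Function.Base using (_∘_)
open import Relation.Binary.PropositionalEquality
open import Relation.Nullary using (yes; no; contradiction)
open import Relation.Unary using (Universal)

open Algebra.Properties.CommutativeMonoid.Sum +-0-commutativeMonoid
  using (sum; sum-cong-≗; ∑-distrib-+; ∑-comm; sum-replicate-zero; sum-init-last)
open Algebra.Properties.Semiring.Sum +-*-semiring using (*-distribˡ-sum; *-distribʳ-sum)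

private variable
  a b b′ h k m n : ℕ

-- Indicators and finite sums

bit : Bool → ℕ
bit x = if x then 1 else 0

bit-<ᵇ : m ≤ n → n ≤ suc m → bit (m <ᵇ n) + m ≡ n
bit-<ᵇ {zero}  {zero}        _ _ = refl
bit-<ᵇ {zero}  {suc zero}    _ _ = refl
bit-<ᵇ {zero}  {suc (suc _)} _ (s≤s ())
bit-<ᵇ {suc m} {suc n} (s≤s m≤n) (s≤s n≤1+m) =
  trans (+-suc _ m) (cong suc (bit-<ᵇ m≤n n≤1+m))

sum-const : ∀ n c → sum {n} (λ _ → c) ≡ n * c
sum-const zero    c = refl
sum-const (suc n) c = cong (c +_) (sum-const n c)

sum-mono-≤ : ∀ {n} {f g : Fin n → ℕ} → (∀ i → f i ≤ g i) → sum f ≤ sum g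
sum-mono-≤ {zero}  f≤g = z≤n
sum-mono-≤ {suc n} f≤g = +-mono-≤ (f≤g zero) (sum-mono-≤ (f≤g ∘ suc))

sum-only : ∀ {n} (f : Fin n → ℕ) i → (∀ i′ → i′ ≢ i → f i′ ≡ 0) → sum f ≡ f i
sum-only {suc n} f zero f≡0 = begin
  f zero + sum (f ∘ suc)        ≡⟨ cong (f zero +_) (sum-cong-≗ (λ i → f≡0 (suc i) λ ())) ⟩
  f zero + sum {n} (λ _ → 0)    ≡⟨ cong (f zero +_) (sum-replicate-zero n) ⟩
  f zero + 0                    ≡⟨ +-identityʳ _ ⟩
  f zero                        ∎
  where open ≡-Reasoning
sum-only {suc n} f (suc i) f≡0 rewrite f≡0 zero (λ ()) =
  sum-only (f ∘ suc) i (λ i′ i′≢i → f≡0 (suc i′) (i′≢i ∘ suc-injective))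

sum-split : ∀ l {t} (f : Fin (l + t) → ℕ) →
            sum f ≡ sum (λ i → f (i ↑ˡ t)) + sum (λ i → f (l ↑ʳ i))
sum-split zero    f = refl
sum-split (suc l) f = trans (cong (f zero +_) (sum-split l (f ∘ suc))) (sym (+-assoc (f zero) _ _))

-- Line sizes, and spanning restated as domination

columnSize rowSize : VertexSet n n → Fin n → ℕ
columnSize A j = sum λ i → bit (A (j , i))
rowSize    A i = sum λ j → bit (A (j , i))

sum-rowSize : (A : VertexSet n n) → sum (rowSize A) ≡ ∣ A ∣
sum-rowSize A = sym (∑-comm λ j i → bit (A (j , i)))

-- Whole lines replace neighborhoods: a vertex outside `A` adds nothing to its own row and column,
-- so the counts agree.
IsDominating : ℕ → VertexSet n n → Set
IsDominating a A = ∀ j i → A (j , i) ≡ false → a ≤ rowSize A i + columnSize A j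

_ᵀ : VertexSet n n → VertexSet n n
A ᵀ = A ∘ swap

ᵀ-isDominating : {A : VertexSet n n} → IsDominating a A → IsDominating a (A ᵀ)
ᵀ-isDominating {a = a} {A = A} dom j i Aij≡f =
  subst (a ≤_) (+-comm (rowSize A j) (columnSize A i)) (dom i j Aij≡f)

∣𝒩ʳ∣ : (A : VertexSet n n) → ∀ j i → A (j , i) ≡ false → ∣ 𝒩ʳ (j , i) ⊓ A ∣ ≡ rowSize A i
∣𝒩ʳ∣ A j i Aji≡f = sum-cong-≗ λ j′ →
  trans (sum-only (λ i′ → bit ((𝒩ʳ (j , i) ⊓ A) (j′ , i′))) i (off-row j′)) (on-row j′)
  where
  off-row : ∀ j′ i′ → i′ ≢ i → bit ((𝒩ʳ (j , i) ⊓ A) (j′ , i′)) ≡ 0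
  off-row j′ i′ i′≢i with j′ ≟ j | i′ ≟ i
  ... | _     | yes i′≡i = contradiction i′≡i i′≢i
  ... | yes _ | no _     = refl
  ... | no _  | no _     = refl

  on-row : ∀ j′ → bit ((𝒩ʳ (j , i) ⊓ A) (j′ , i)) ≡ bit (A (j′ , i))
  on-row j′ with j′ ≟ j | i ≟ i
  ... | _        | no i≢i = contradiction refl i≢i
  ... | yes refl | yes _  = cong bit (sym Aji≡f)
  ... | no _     | yes _  = refl

∣𝒩ᶜ∣ : (A : VertexSet n n) → ∀ j i → A (j , i) ≡ false → ∣ 𝒩ᶜ (j , i) ⊓ A ∣ ≡ columnSize A j
∣𝒩ᶜ∣ {n} A j i Aji≡f =
  trans (sum-only (λ j′ → sum λ i′ → bit ((𝒩ᶜ (j , i) ⊓ A) (j′ , i′))) j off-column)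
        (sum-cong-≗ on-column)
  where
  off-column : ∀ j′ → j′ ≢ j → sum (λ i′ → bit ((𝒩ᶜ (j , i) ⊓ A) (j′ , i′))) ≡ 0
  off-column j′ j′≢j with j′ ≟ j
  ... | yes j′≡j = contradiction j′≡j j′≢j
  ... | no _     = sum-replicate-zero n

  on-column : ∀ i′ → bit ((𝒩ᶜ (j , i) ⊓ A) (j , i′)) ≡ bit (A (j , i′))
  on-column i′ with j ≟ j | i′ ≟ i
  ... | no j≢j | _        = contradiction refl j≢j
  ... | yes _  | yes refl = cong bit (sym Aji≡f)
  ... | yes _  | no _     = refl

-- `1 ≤ a` keeps `a ∸ 1` from truncating, so that leaving `T a` means having at least `a` neighbors
-- in `A`.
dominating⇒spanning : 1 ≤ a → (A : VertexSet n n) → IsDominating a A → Universal (𝒯 (T a) A)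
dominating⇒spanning {suc a} _ A dom (j , i) with A (j , i) in Aji
... | true  = inj₁ refl
... | false = inj₂ ((λ ()) , λ x+y≤a → <⇒≱ (dom j i Aji)
  (subst₂ (λ x y → x + y ≤ a) (∣𝒩ʳ∣ A j i Aji) (∣𝒩ᶜ∣ A j i Aji) x+y≤a))

spanning⇒dominating : (A : VertexSet n n) → Universal (𝒯 (T a) A) → IsDominating a A
spanning⇒dominating {a = a} A span j i Aji with span (j , i)
... | inj₁ Aji≡t = contradiction (trans (sym Aji≡t) Aji) λ ()
... | inj₂ (_ , x+y≰) = ≤-trans (m≤n+m∸n a 1)
  (≰⇒> (x+y≰ ∘ subst₂ (λ x y → x + y ≤ a ∸ 1) (sym (∣𝒩ʳ∣ A j i Aji)) (sym (∣𝒩ᶜ∣ A j i Aji))))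

γ-intro : 1 ≤ a → (A : VertexSet n n) → IsDominating a A → ∣ A ∣ ≡ k →
          (∀ (B : VertexSet n n) → IsDominating a B → k ≤ ∣ B ∣) → Isγ (T a) n n k
γ-intro 1≤a A dom ∣A∣≡k least =
  (A , dominating⇒spanning 1≤a A dom , ∣A∣≡k) ,
  λ { _ (B , span , refl) → least B (spanning⇒dominating B span) }

-- Lower bounds

-- With x the indicator of `(j , i)`, domination says (1 - x)(r i + c - a) ≥ 0. This is summed over
-- i, with the negative terms moved across to stay in ℕ.
column-inequality : (A : VertexSet n n) → IsDominating a A → ∀ j →
  n * a + (sum (λ i → bit (A (j , i)) * rowSize A i) + columnSize A j * columnSize A j)
  ≤ ∣ A ∣ + (n * columnSize A j + a * columnSize A j)
column-inequality {n} {a} A dom j = subst₂ _≤_ lhs rhs (sum-mono-≤ pointwise)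
  where
  c = columnSize A j
  x : Fin n → ℕ
  x i = bit (A (j , i))
  r = rowSize A

  pointwise : ∀ i → a + (x i * r i + x i * c) ≤ r i + (c + a * x i)
  pointwise i with A (j , i) in Aji
  ... | true  = ≤-reflexive (true-case a (r i) c)
    where
    true-case : ∀ a r c → a + (1 * r + 1 * c) ≡ r + (c + a * 1)
    true-case = solve-∀
  ... | false = subst₂ _≤_ (sym (+-identityʳ a)) (false-case a (r i) c) (dom j i Aji)
    where
    false-case : ∀ a r c → r + c ≡ r + (c + a * 0)
    false-case = solve-∀

  lhs : sum {n} (λ i → a + (x i * r i + x i * c)) ≡ n * a + (sum (λ i → x i * r i) + c * c)
  lhs = trans (∑-distrib-+ {n} (λ _ → a) _) (cong₂ _+_ (sum-const n a)
    (trans (∑-distrib-+ (λ i → x i * r i) _) (cong₂ _+_ refl (sym (*-distribʳ-sum c x)))))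

  rhs : sum {n} (λ i → r i + (c + a * x i)) ≡ ∣ A ∣ + (n * c + a * c)
  rhs = trans (∑-distrib-+ r _) (cong₂ _+_ (sum-rowSize A)
    (trans (∑-distrib-+ {n} (λ _ → c) _) (cong₂ _+_ (sum-const n c) (sym (*-distribˡ-sum a x)))))

-- (r − b)(r − b′) ≥ 0, as no integer lies strictly between b and b′.
consecutive-product : b ≤ b′ → b′ ≤ suc b → ∀ r → (b + b′) * r ≤ r * r + b * b′
consecutive-product {b} {b′} b≤b′ b′≤1+b r with r ≤? b
... | yes r≤b with d , refl ← m≤n⇒∃[o]m+o≡n r≤b
              with e , refl ← m≤n⇒∃[o]m+o≡n (≤-trans r≤b b≤b′) =
  m+n≤o⇒m≤o _ (≤-reflexive (below r d e))
  where
  below : ∀ r d e → (r + d + (r + e)) * r + d * e ≡ r * r + (r + d) * (r + e)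
  below = solve-∀
... | no r≰b with f , refl ← m≤n⇒∃[o]m+o≡n b≤b′
             with e , refl ← m≤n⇒∃[o]m+o≡n (≤-trans b′≤1+b (≰⇒> r≰b)) =
  m+n≤o⇒m≤o _ (≤-reflexive (above b f e))
  where
  above : ∀ b f e → (b + (b + f)) * (b + f + e) + (f + e) * e
                  ≡ (b + f + e) * (b + f + e) + b * (b + f)
  above = solve-∀

sum-of-squares : b ≤ b′ → b′ ≤ suc b → (f : Fin n → ℕ) →
                 (b + b′) * sum f ≤ sum (λ i → f i * f i) + n * (b * b′)
sum-of-squares {b} {b′} {n} b≤b′ b′≤1+b f = begin
  (b + b′) * sum f                        ≡⟨ *-distribˡ-sum (b + b′) f ⟩
  sum (λ i → (b + b′) * f i)              ≤⟨ sum-mono-≤ (consecutive-product b≤b′ b′≤1+b ∘ f) ⟩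
  sum (λ i → f i * f i + b * b′)          ≡⟨ ∑-distrib-+ (λ i → f i * f i) _ ⟩
  sum (λ i → f i * f i) + sum {n} (λ _ → b * b′) ≡⟨ cong (_ +_) (sum-const n (b * b′)) ⟩
  sum (λ i → f i * f i) + n * (b * b′)    ∎
  where open ≤-Reasoning

-- Summing `column-inequality` over the columns puts both sums of squares on the smaller side;
-- `sum-of-squares` trades them for terms linear in s.
counting-bound : b ≤ b′ → b′ ≤ suc b → (A : VertexSet n n) → IsDominating (b + b′) A →
  let a = b + b′; s = ∣ A ∣ in
  n * (n * a) + (a * s + a * s) ≤ n * s + (n * s + a * s) + (n * (b * b′) + n * (b * b′))
counting-bound {b} {b′} {n} b≤b′ b′≤1+b A dom = begin
  n * (n * e) + (e * s + e * s)
    ≤⟨ +-monoʳ-≤ (n * (n * e)) (+-mono-≤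
         (subst (λ s → e * s ≤ Σr² + n * (b * b′)) (sum-rowSize A) (sum-of-squares b≤b′ b′≤1+b r))
         (sum-of-squares b≤b′ b′≤1+b c)) ⟩
  n * (n * e) + (Σr² + n * (b * b′) + (Σc² + n * (b * b′)))
    ≡⟨ regroup (n * (n * e)) Σr² Σc² (n * (b * b′)) ⟩
  n * (n * e) + (Σr² + Σc²) + (n * (b * b′) + n * (b * b′))
    ≤⟨ +-monoˡ-≤ _ (subst₂ _≤_ lhs rhs (sum-mono-≤ (column-inequality A dom))) ⟩
  n * s + (n * s + e * s) + (n * (b * b′) + n * (b * b′)) ∎
  where
  open ≤-Reasoning
  e = b + b′
  s = ∣ A ∣
  c = columnSize A
  r = rowSize A
  x : Fin n → Fin n → ℕ
  x j i = bit (A (j , i))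
  Σr² = sum λ i → r i * r i
  Σc² = sum λ j → c j * c j

  regroup : ∀ u v w z → u + (v + z + (w + z)) ≡ u + (v + w) + (z + z)
  regroup = solve-∀

  -- Row i is counted once for each of its `r i` vertices.
  Σxr : sum (λ j → sum λ i → x j i * r i) ≡ Σr²
  Σxr = trans (∑-comm λ j i → x j i * r i)
    (sum-cong-≗ λ i → sym (*-distribʳ-sum (r i) (λ j → x j i)))

  lhs : sum (λ j → n * e + (sum (λ i → x j i * r i) + c j * c j)) ≡ n * (n * e) + (Σr² + Σc²)
  lhs = trans (∑-distrib-+ {n} (λ _ → n * e) _) (cong₂ _+_ (sum-const n (n * e))
    (trans (∑-distrib-+ (λ j → sum λ i → x j i * r i) _) (cong (_+ Σc²) Σxr)))

  rhs : sum (λ j → s + (n * c j + e * c j)) ≡ n * s + (n * s + e * s)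
  rhs = trans (∑-distrib-+ {n} (λ _ → s) _) (cong₂ _+_ (sum-const n s)
    (trans (∑-distrib-+ (λ j → n * c j) _)
      (cong₂ _+_ (sym (*-distribˡ-sum n c)) (sym (*-distribˡ-sum e c)))))

-- With b′ = b, removing the terms common to both sides of `counting-bound` leaves 2(n - b) · bn ≤
-- 2(n - b) · s, and n - b = `suc h` is positive.
even-bound : b < n → (A : VertexSet n n) → IsDominating (b + b) A → b * n ≤ ∣ A ∣
even-bound {b} b<n A dom with h , refl ← m≤n⇒∃[o]m+o≡n b<n =
  *-cancelˡ-≤ (2 * suc h)
    (+-cancelˡ-≤ (2 * ((b + b) * s) + 2 * ((suc b + h) * (b * b))) _ _
      (subst₂ _≤_ (lhs b h s) (rhs b h s) (counting-bound ≤-refl (n≤1+n b) A dom)))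
  where
  s = ∣ A ∣
  lhs : ∀ b h s → let n = suc b + h; a = b + b in
        n * (n * a) + (a * s + a * s)
        ≡ 2 * (a * s) + 2 * (n * (b * b)) + 2 * suc h * (b * n)
  lhs = solve-∀
  rhs : ∀ b h s → let n = suc b + h; a = b + b in
        n * s + (n * s + a * s) + (n * (b * b) + n * (b * b))
        ≡ 2 * (a * s) + 2 * (n * (b * b)) + 2 * suc h * s
  rhs = solve-∀

-- With b′ = b + 1 the remaining coefficient of s is 2n - a = 2h + 1, giving s ≥ bn + n(h + 1)/(2h +
-- 1). Rounding up is left to `quotient-bound`.
odd-bound : (A : VertexSet (suc b + h) (suc b + h)) → IsDominating (b + suc b) A →
            let n = suc b + h in suc (2 * h) * (b * n) + n * suc h ≤ suc (2 * h) * ∣ A ∣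
odd-bound {b} {h} A dom =
  +-cancelˡ-≤ (2 * ((b + suc b) * s) + 2 * ((suc b + h) * (b * suc b))) _ _
    (subst₂ _≤_ (lhs b h s) (rhs b h s) (counting-bound (n≤1+n b) ≤-refl A dom))
  where
  s = ∣ A ∣
  lhs : ∀ b h s → let n = suc b + h; a = b + suc b in
        n * (n * a) + (a * s + a * s)
        ≡ 2 * (a * s) + 2 * (n * (b * suc b)) + (suc (2 * h) * (b * n) + n * suc h)
  lhs = solve-∀
  rhs : ∀ b h s → let n = suc b + h; a = b + suc b in
        n * s + (n * s + a * s) + (n * (b * suc b) + n * (b * suc b))
        ≡ 2 * (a * s) + 2 * (n * (b * suc b)) + suc (2 * h) * s
  rhs = solve-∀

-- The n - c rows that meet column `j` outside `A` have at least a - c vertices each, the other c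
-- rows at least c each. Hence `A` has at least (n - c)(a - c) + c² vertices.
light-column-bound : b + suc b ≤ n → (A : VertexSet n n) → IsDominating (b + suc b) A →
  ∀ j → columnSize A j ≤ b → (∀ i → columnSize A j ≤ rowSize A i) →
  suc b * n ≤ ∣ A ∣ + b
light-column-bound {b} {n} a≤n A dom j c≤b c≤rows = lemma c≤b a≤n total
  where
  open ≤-Reasoning
  c = columnSize A j

  total : n * (b + suc b) + (c * c + c * c) ≤ ∣ A ∣ + (n * c + (b + suc b) * c)
  total = ≤-trans (+-monoʳ-≤ (n * (b + suc b)) (+-monoˡ-≤ (c * c) (begin
    c * c                                        ≡⟨ *-distribʳ-sum c (λ i → bit (A (j , i))) ⟩
    sum (λ i → bit (A (j , i)) * c)              ≤⟨ sum-mono-≤ (λ i → *-monoʳ-≤ (bit (A (j , i))) (c≤rows i)) ⟩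
    sum (λ i → bit (A (j , i)) * rowSize A i)    ∎)))
    (column-inequality A dom j)

  -- f(c) = 2c² − (n + a)c + na is decreasing on [0,b], and f(b) = (b+1)n − b.
  lemma : ∀ {c s} → c ≤ b → b + suc b ≤ n →
          n * (b + suc b) + (c * c + c * c) ≤ s + (n * c + (b + suc b) * c) →
          suc b * n ≤ s + b
  lemma {c} {s} c≤b a≤n total
    with d , refl ← m≤n⇒∃[o]m+o≡n c≤b
    with e , refl ← m≤n⇒∃[o]m+o≡n a≤n =
    +-cancelʳ-≤ (n * c + (b + suc b) * c) _ _ (begin
      suc b * n + (n * c + (b + suc b) * c)
        -- The slack is f(c) - f(b), where d = b - c and e = n - a.
        ≤⟨ m+n≤o⇒m≤o _ {d * (2 * d + 2 + e)} (≤-reflexive (difference c d e)) ⟩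
      n * (b + suc b) + (c * c + c * c) + b    ≤⟨ +-monoˡ-≤ b total ⟩
      s + (n * c + (b + suc b) * c) + b        ≡⟨ +-assoc s _ b ⟩
      s + (n * c + (b + suc b) * c + b)        ≡⟨ cong (s +_) (+-comm _ b) ⟩
      s + (b + (n * c + (b + suc b) * c))      ≡⟨ +-assoc s b _ ⟨
      s + b + (n * c + (b + suc b) * c)        ∎)
    where
    difference : ∀ c d e → let b = c + d; n = b + suc b + e in
      suc b * n + (n * c + (b + suc b) * c) + d * (2 * d + 2 + e)
      ≡ n * (b + suc b) + (c * c + c * c) + b
    difference = solve-∀

-- If every line has more than b vertices, the columns alone give (b + 1)n. Otherwise
-- `light-column-bound` applies to a smallest line, after transposing if that line is a row.
small-odd-bound : b + suc b ≤ n → (A : VertexSet n n) → IsDominating (b + suc b) A →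
                  suc b * n ≤ ∣ A ∣ + b
small-odd-bound {b} {n} a≤n A dom = raise (suc b) 0 (+-identityʳ (suc b)) (λ _ → z≤n) (λ _ → z≤n)
  where
  -- Upward search for the smallest line size: r is a lower bound for all lines so far, d the
  -- distance left to b + 1.
  raise : ∀ d r → d + r ≡ suc b → (∀ j → r ≤ columnSize A j) → (∀ i → r ≤ rowSize A i) →
          suc b * n ≤ ∣ A ∣ + b
  raise zero r refl r≤columns _ = begin
    suc b * n              ≡⟨ *-comm (suc b) n ⟩
    n * suc b              ≡⟨ sum-const n (suc b) ⟨
    sum {n} (λ _ → suc b)  ≤⟨ sum-mono-≤ r≤columns ⟩
    ∣ A ∣                  ≤⟨ m≤m+n _ b ⟩
    ∣ A ∣ + b              ∎
    where open ≤-Reasoning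
  raise (suc d) r d+r≡b r≤columns r≤rows
    with any? (λ j → columnSize A j ≤? r) | any? (λ i → rowSize A i ≤? r)
  ... | yes (j , c≤r) | _ =
    light-column-bound a≤n A dom j (≤-trans c≤r (m+n≤o⇒n≤o d (≤-reflexive (cong (_∸ 1) d+r≡b))))
      (λ i → ≤-trans c≤r (r≤rows i))
  ... | no _ | yes (i , c≤r) =
    subst (λ s → suc b * n ≤ s + b) (sum-rowSize A)
      (light-column-bound a≤n (A ᵀ) (ᵀ-isDominating {A = A} dom) i
        (≤-trans c≤r (m+n≤o⇒n≤o d (≤-reflexive (cong (_∸ 1) d+r≡b))))
        (λ j → ≤-trans c≤r (r≤columns j)))
  ... | no c≰r | no r≰r =
    raise d (suc r) (trans (+-suc d r) d+r≡b)
      (λ j → ≰⇒> (λ c≤r → c≰r (j , c≤r))) (λ i → ≰⇒> (λ c≤r → r≰r (i , c≤r)))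

-- Constructions

-- Filling p cells cyclically around t + 1 columns, starting with the last
-- column, puts cyclic p j of them in column j.
cyclic : ℕ → Fin (suc m) → ℕ
cyclic {m} p j = (p + toℕ j) / suc m

cyclic-mono-≤ : ∀ {p q} (j : Fin (suc m)) → p ≤ q → cyclic p j ≤ cyclic q j
cyclic-mono-≤ {m} j p≤q = /-monoˡ-≤ (suc m) (+-monoˡ-≤ (toℕ j) p≤q)

cyclic-+ : ∀ p q (j : Fin (suc m)) → cyclic (q * suc m + p) j ≡ q + cyclic p j
cyclic-+ {m} p q j = begin
  (q * suc m + p + toℕ j) / suc m          ≡⟨ /-congˡ (+-assoc (q * suc m) p (toℕ j)) ⟩
  (q * suc m + (p + toℕ j)) / suc m        ≡⟨ +-distrib-/-∣ˡ (p + toℕ j) (divides-refl q) ⟩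
  q * suc m / suc m + cyclic p j           ≡⟨ cong (_+ cyclic p j) (m*n/n≡m q (suc m)) ⟩
  q + cyclic p j                           ∎
  where open ≡-Reasoning

cyclic-0 : (j : Fin (suc m)) → cyclic 0 j ≡ 0
cyclic-0 j = m<n⇒m/n≡0 (toℕ<n j)

cyclic-* : ∀ q (j : Fin (suc m)) → cyclic (q * suc m) j ≡ q
cyclic-* {m} q j = begin
  cyclic (q * suc m) j        ≡⟨ cong (λ p → cyclic p j) (+-identityʳ (q * suc m)) ⟨
  cyclic (q * suc m + 0) j    ≡⟨ cyclic-+ 0 q j ⟩
  q + cyclic 0 j              ≡⟨ cong (q +_) (cyclic-0 j) ⟩
  q + 0                       ≡⟨ +-identityʳ q ⟩
  q                           ∎
  where open ≡-Reasoning

-- At most one full turn is added, and a full turn adds one cell to each column.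
cyclic-step : ∀ p {r} (j : Fin (suc m)) → r ≤ suc m → cyclic (p + r) j ≤ suc (cyclic p j)
cyclic-step {m} p {r} j r≤1+m = begin
  cyclic (p + r) j            ≤⟨ cyclic-mono-≤ j (+-monoʳ-≤ p r≤1+m) ⟩
  cyclic (p + suc m) j        ≡⟨ cong (λ q → cyclic q j) (trans (+-comm p (suc m)) (cong (_+ p) (sym (*-identityˡ (suc m))))) ⟩
  cyclic (1 * suc m + p) j    ≡⟨ cyclic-+ p 1 j ⟩
  suc (cyclic p j)            ∎
  where open ≤-Reasoning

-- Hermite's identity.
sum-cyclic : ∀ m p → sum (cyclic {m} p) ≡ p
sum-cyclic m zero    = trans (sum-cong-≗ (cyclic-0 {m})) (sum-replicate-zero (suc m))
-- The sum of m + 2 consecutive quotients is split in two ways, at its first and at its last term;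
-- the last exceeds the first by one.
sum-cyclic m (suc p) = +-cancelˡ-≡ (p / suc m) _ _ (begin
  p / suc m + sum (cyclic {m} (suc p))
    ≡⟨ cong₂ _+_ (/-congˡ {suc m} (+-identityʳ p)) (sum-cong-≗ {suc m} (λ j → /-congˡ {suc m} (+-suc p (toℕ j)))) ⟨
  sum shifted
    ≡⟨ sum-init-last shifted ⟩
  sum {suc m} (λ j → shifted (inject₁ j)) + shifted (fromℕ (suc m))
    ≡⟨ cong₂ _+_ (trans (sum-cong-≗ {suc m} (λ j → /-congˡ {suc m} (cong (p +_) (toℕ-inject₁ j)))) (sum-cyclic m p))
                 (/-congˡ {suc m} (cong (p +_) (toℕ-fromℕ (suc m)))) ⟩
  p + (p + suc m) / suc m
    ≡⟨ cong (p +_) (trans (+-distrib-/-∣ʳ p (∣-refl {suc m})) (cong (p / suc m +_) (n/n≡1 (suc m)))) ⟩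
  p + (p / suc m + 1)
    ≡⟨ rotate p (p / suc m) ⟩
  p / suc m + suc p ∎)
  where
  open ≡-Reasoning
  shifted : Fin (suc (suc m)) → ℕ
  shifted j = (p + toℕ j) / suc m
  rotate : ∀ p q → p + (q + 1) ≡ q + suc p
  rotate = solve-∀

-- Row i occupies the r i cells that follow, cyclically, those of the previous rows.
strip : ℕ → (Fin n → ℕ) → Fin n → Fin (suc m) → Bool
strip p r zero    j = cyclic p j <ᵇ cyclic (p + r zero) j
strip p r (suc i) j = strip (p + r zero) (r ∘ suc) i j

strip-cell : ∀ p {r} (j : Fin (suc m)) → r ≤ suc m →
             bit (cyclic p j <ᵇ cyclic (p + r) j) + cyclic p j ≡ cyclic (p + r) j
strip-cell p j r≤1+m = bit-<ᵇ (cyclic-mono-≤ j (m≤m+n p _)) (cyclic-step p j r≤1+m)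

-- The cells are the increments of `cyclic` from p to p + r, whose totals over the columns are known
-- from `sum-cyclic`.
sum-strip-row : ∀ p (r : Fin n → ℕ) → (∀ i → r i ≤ suc m) →
                ∀ i → sum {suc m} (λ j → bit (strip p r i j)) ≡ r i
sum-strip-row {m = m} p r r≤1+m zero = +-cancelʳ-≡ p _ _ (begin
  sum cell + p                                 ≡⟨ cong (sum cell +_) (sum-cyclic m p) ⟨
  sum cell + sum (cyclic {m} p)                ≡⟨ ∑-distrib-+ cell (cyclic p) ⟨
  sum (λ j → cell j + cyclic p j)              ≡⟨ sum-cong-≗ (λ j → strip-cell p j (r≤1+m zero)) ⟩
  sum (cyclic {m} (p + r zero))                ≡⟨ sum-cyclic m (p + r zero) ⟩
  p + r zero                                   ≡⟨ +-comm p (r zero) ⟩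
  r zero + p                                   ∎)
  where
  open ≡-Reasoning
  cell : Fin (suc m) → ℕ
  cell j = bit (strip p r zero j)
sum-strip-row p r r≤1+m (suc i) = sum-strip-row (p + r zero) (r ∘ suc) (r≤1+m ∘ suc) i

-- The increments telescope down the rows, so a column depends only on where the strip starts and
-- ends, not on the individual row lengths.
sum-strip-column : ∀ p (r : Fin n → ℕ) → (∀ i → r i ≤ suc m) →
                   ∀ (j : Fin (suc m)) → sum (λ i → bit (strip p r i j)) + cyclic p j ≡ cyclic (p + sum r) j
sum-strip-column {zero}  p r r≤1+m j = cong (λ q → cyclic q j) (sym (+-identityʳ p))
sum-strip-column {suc n} p r r≤1+m j = begin
  cell + rest + cyclic p j             ≡⟨ cong (_+ cyclic p j) (+-comm cell rest) ⟩
  rest + cell + cyclic p j             ≡⟨ +-assoc rest cell _ ⟩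
  rest + (cell + cyclic p j)           ≡⟨ cong (rest +_) (strip-cell p j (r≤1+m zero)) ⟩
  rest + cyclic (p + r zero) j         ≡⟨ sum-strip-column (p + r zero) (r ∘ suc) (r≤1+m ∘ suc) j ⟩
  cyclic (p + r zero + sum (r ∘ suc)) j ≡⟨ cong (λ q → cyclic q j) (+-assoc p (r zero) _) ⟩
  cyclic (p + sum r) j                 ∎
  where
  open ≡-Reasoning
  cell = bit (strip p r zero j)
  rest = sum λ i → bit (strip p r (suc i) j)

sum-strip-column₀ : ∀ (r : Fin n → ℕ) → (∀ i → r i ≤ suc m) →
                    ∀ (j : Fin (suc m)) → sum (λ i → bit (strip 0 r i j)) ≡ cyclic (sum r) j
sum-strip-column₀ r r≤1+m j =
  trans (sym (trans (cong₂ _+_ refl (cyclic-0 j)) (+-identityʳ _))) (sum-strip-column 0 r r≤1+m j)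

-- The strip's rows serve as the columns of `A`. Its n runs of b cells make exactly b full turns, so
-- the other direction also has b cells per line.
even-construction : b ≤ n → 1 ≤ n →
  ∃ λ (A : VertexSet n n) → IsDominating (b + b) A × ∣ A ∣ ≡ b * n
even-construction {b} {n@(suc m)} b≤n _ = A , dominating , size
  where
  A : VertexSet n n
  A (j , i) = strip 0 (λ _ → b) j i

  columns : ∀ j → columnSize A j ≡ b
  columns = sum-strip-row 0 (λ _ → b) (λ _ → b≤n)

  rows : ∀ i → rowSize A i ≡ b
  rows i = begin
    rowSize A i                    ≡⟨ sum-strip-column₀ {n} (λ _ → b) (λ _ → b≤n) i ⟩
    cyclic (sum {n} (λ _ → b)) i   ≡⟨ cong (λ p → cyclic p i) (trans (sum-const n b) (*-comm n b)) ⟩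
    cyclic (b * n) i               ≡⟨ cyclic-* b i ⟩
    b                              ∎
    where open ≡-Reasoning

  dominating : IsDominating (b + b) A
  dominating j i _ = ≤-reflexive (sym (cong₂ _+_ (rows i) (columns j)))

  size : ∣ A ∣ ≡ b * n
  size = trans (sum-cong-≗ columns) (trans (sum-const n b) (*-comm n b))

-- Odd thresholds: light and heavy lines

sum-splitAt : ∀ l {m} (f : Fin l ⊎ Fin m → ℕ) →
              sum (f ∘ splitAt l) ≡ sum (f ∘ inj₁) + sum (f ∘ inj₂)
sum-splitAt l {m} f = trans (sum-split l (f ∘ splitAt l)) (cong₂ _+_
  (sum-cong-≗ (λ i → cong f (splitAt-↑ˡ l i m)))
  (sum-cong-≗ (λ i → cong f (splitAt-↑ʳ l m i))))

-- Here b = l + g, and l and heavy are the numbers of light and heavy lines. The strip of the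
-- heavy rows continues that of the light ones, so that the heavy columns are filled evenly;
-- a heavy row gets what the transpose of the light strip leaves missing.
module Block (l g h : ℕ) (balance : l * suc h ≤ suc (g + h) * h) where

  heavy : ℕ
  heavy = suc (g + h)

  -- The number of cells that the light strip `top` places in heavy line `v`: each of the l light
  -- lines still needs g = b - l cells there.
  crossing : Fin heavy → ℕ
  crossing = cyclic (l * g)

  filling : Fin heavy → ℕ
  filling v = suc (l + g) ∸ crossing v

  g≤heavy : g ≤ heavy
  g≤heavy = ≤-trans (m≤m+n g h) (n≤1+n (g + h))

  crossing≤ : ∀ v → crossing v ≤ suc (l + g)
  crossing≤ v = begin
    cyclic (l * g) v        ≤⟨ cyclic-mono-≤ v (*-monoʳ-≤ l g≤heavy) ⟩
    cyclic (l * heavy) v    ≡⟨ cyclic-* l v ⟩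
    l                       ≤⟨ m≤m+n l g ⟩
    l + g                   ≤⟨ n≤1+n (l + g) ⟩
    suc (l + g)             ∎
    where open ≤-Reasoning

  -- The claim amounts to `crossing v` ≥ l - h, which is trivial for l ≤ h. Otherwise `balance`
  -- gives (l - h) · `heavy` ≤ l · g, so the light strip makes at least q = l - h full turns.
  filling≤ : ∀ v → filling v ≤ heavy
  filling≤ v with l ≤? h
  ... | yes l≤h = ≤-trans (m∸n≤m _ (crossing v))
          (s≤s (≤-trans (+-monoˡ-≤ g l≤h) (≤-reflexive (+-comm h g))))
  ... | no l≰h with q , refl ← m≤n⇒∃[o]m+o≡n (<⇒≤ (≰⇒> l≰h)) =
    m≤n+o⇒m∸n≤o (suc (h + q + g)) (crossing v) (begin
      suc (h + q + g)         ≡⟨ rearrange g h q ⟩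
      q + heavy               ≤⟨ +-monoˡ-≤ heavy q≤crossing ⟩
      crossing v + heavy       ∎)
    where
    open ≤-Reasoning
    rearrange : ∀ g h q → suc (h + q + g) ≡ q + suc (g + h)
    rearrange = solve-∀
    cancelled : ∀ g h q → suc (g + h) * h ≡ g * h + (h * h + h)
    cancelled = solve-∀
    cancelled′ : ∀ h q → (h + q) * suc h ≡ q * suc h + (h * h + h)
    cancelled′ = solve-∀
    expand : ∀ g h q → q * suc (g + h) ≡ q * g + q * suc h
    expand = solve-∀
    contract : ∀ g h q → q * g + g * h ≡ (h + q) * g
    contract = solve-∀
    q≤crossing : q ≤ crossing v
    q≤crossing = begin
      q                         ≡⟨ cyclic-* q v ⟨
      cyclic (q * heavy) v      ≤⟨ cyclic-mono-≤ v (begin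
        q * heavy               ≡⟨ expand g h q ⟩
        q * g + q * suc h       ≤⟨ +-monoʳ-≤ (q * g) (+-cancelʳ-≤ (h * h + h) _ _
                                     (subst₂ _≤_ (cancelled′ h q) (cancelled g h q) balance)) ⟩
        q * g + g * h           ≡⟨ contract g h q ⟩
        (h + q) * g             ∎) ⟩
      crossing v                 ∎

  top : Fin l → Fin heavy → Bool
  top = strip 0 (λ _ → g)

  bottom : Fin heavy → Fin heavy → Bool
  bottom = strip (l * g) filling

  -- The light-light block is full because a vertex outside the set there would see only 2b = a - 1
  -- vertices.
  cell : Fin l ⊎ Fin heavy → Fin l ⊎ Fin heavy → Bool
  cell (inj₁ _) (inj₁ _) = true
  cell (inj₁ u) (inj₂ v) = top u v
  cell (inj₂ v) (inj₁ u) = top u v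
  cell (inj₂ v) (inj₂ w) = bottom v w

  size : Fin l ⊎ Fin heavy → ℕ
  size = [ (λ _ → l + g) , (λ _ → suc (l + g)) ]′

  A : VertexSet (l + heavy) (l + heavy)
  A (j , i) = cell (splitAt l j) (splitAt l i)

  sum-top-row : ∀ u → sum (λ v → bit (top u v)) ≡ g
  sum-top-row = sum-strip-row 0 (λ _ → g) (λ _ → g≤heavy)

  sum-top-column : ∀ v → sum (λ u → bit (top u v)) ≡ crossing v
  sum-top-column v = trans (sum-strip-column₀ {l} (λ _ → g) (λ _ → g≤heavy) v)
    (cong (λ p → cyclic p v) (sum-const l g))

  -- Together the two strips make exactly b + 1 full turns.
  filling-total : l * g + sum filling ≡ suc (l + g) * heavy
  filling-total = begin
    l * g + sum filling                      ≡⟨ cong (_+ sum filling) (sum-cyclic (g + h) (l * g)) ⟨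
    sum crossing + sum filling                ≡⟨ ∑-distrib-+ crossing filling ⟨
    sum (λ v → crossing v + filling v)        ≡⟨ sum-cong-≗ (λ v → m+[n∸m]≡n (crossing≤ v)) ⟩
    sum {heavy} (λ _ → suc (l + g))          ≡⟨ sum-const heavy (suc (l + g)) ⟩
    heavy * suc (l + g)                      ≡⟨ *-comm heavy (suc (l + g)) ⟩
    suc (l + g) * heavy                      ∎
    where open ≡-Reasoning

  sum-cell-column : ∀ x → sum (λ u → bit (cell x (inj₁ u))) + sum (λ v → bit (cell x (inj₂ v))) ≡ size x
  sum-cell-column (inj₁ u) =
    cong₂ _+_ (trans (sum-const l 1) (*-identityʳ l)) (sum-top-row u)
  sum-cell-column (inj₂ v) =
    trans (cong₂ _+_ (sum-top-column v) (sum-strip-row (l * g) filling filling≤ v))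
          (m+[n∸m]≡n (crossing≤ v))

  -- A heavy column has the right size by the choice of `filling`; a heavy row has it because
  -- `bottom` resumes at `l * g`, where `top` stops, and ends after whole turns.
  sum-cell-row : ∀ y → sum (λ u → bit (cell (inj₁ u) y)) + sum (λ v → bit (cell (inj₂ v) y)) ≡ size y
  sum-cell-row (inj₁ u) =
    cong₂ _+_ (trans (sum-const l 1) (*-identityʳ l)) (sum-top-row u)
  sum-cell-row (inj₂ w) = begin
    sum (λ u → bit (top u w)) + Σbottom     ≡⟨ cong (_+ Σbottom) (sum-top-column w) ⟩
    crossing w + Σbottom                     ≡⟨ +-comm (crossing w) Σbottom ⟩
    Σbottom + crossing w                     ≡⟨ sum-strip-column (l * g) filling filling≤ w ⟩
    cyclic (l * g + sum filling) w          ≡⟨ cong (λ p → cyclic p w) filling-total ⟩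
    cyclic (suc (l + g) * heavy) w          ≡⟨ cyclic-* (suc (l + g)) w ⟩
    suc (l + g)                             ∎
    where
    open ≡-Reasoning
    Σbottom = sum λ v → bit (bottom v w)

  columns : ∀ j → columnSize A j ≡ size (splitAt l j)
  columns j = trans (sum-splitAt l (λ y → bit (cell (splitAt l j) y))) (sum-cell-column (splitAt l j))

  rows : ∀ i → rowSize A i ≡ size (splitAt l i)
  rows i = trans (sum-splitAt l (λ x → bit (cell x (splitAt l i)))) (sum-cell-row (splitAt l i))

  -- A light and a heavy line give exactly a = 2b + 1, two heavy lines one more.
  cell-dominated : ∀ x y → cell x y ≡ false → (l + g) + suc (l + g) ≤ size y + size x
  cell-dominated (inj₁ _) (inj₂ _) _ = ≤-reflexive (+-suc (l + g) (l + g))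
  cell-dominated (inj₂ _) (inj₁ _) _ = ≤-refl
  cell-dominated (inj₂ _) (inj₂ _) _ = n≤1+n _

  dominating : IsDominating ((l + g) + suc (l + g)) A
  dominating j i Aji≡f = subst ((l + g) + suc (l + g) ≤_) (sym (cong₂ _+_ (rows i) (columns j)))
    (cell-dominated (splitAt l j) (splitAt l i) Aji≡f)

  ∣A∣ : ∣ A ∣ ≡ (l + g) * (l + heavy) + heavy
  ∣A∣ = begin
    sum (columnSize A)                            ≡⟨ sum-cong-≗ columns ⟩
    sum (size ∘ splitAt l)                        ≡⟨ sum-splitAt l size ⟩
    sum {l} (λ _ → l + g) + sum {heavy} (λ _ → suc (l + g))
                                                  ≡⟨ cong₂ _+_ (sum-const l _) (sum-const heavy _) ⟩
    l * (l + g) + heavy * suc (l + g)             ≡⟨ collect l (l + g) heavy ⟩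
    (l + g) * (l + heavy) + heavy                 ∎
    where
    open ≡-Reasoning
    collect : ∀ l b t → l * b + t * suc b ≡ b * (l + t) + t
    collect = solve-∀

m≤n⇒∃[o]o+m≡n : m ≤ n → ∃[ o ] o + m ≡ n
m≤n⇒∃[o]o+m≡n {m} {n} m≤n = n ∸ m , m∸n+n≡m m≤n

-- Here t counts the heavy lines and l = n - t the light ones. `h < t` means l ≤ b, so the full
-- block fits into the light lines; g = b - l.
odd-construction : ∀ {t} → n ≡ suc b + h → h < t → t ≤ n → n * suc h ≤ t * suc (2 * h) →
  ∃ λ (A : VertexSet n n) → IsDominating (b + suc b) A × ∣ A ∣ ≡ b * n + t
odd-construction {b = b} {h} n≡ h<t t≤n balance
  with g , refl ← m≤n⇒∃[o]o+m≡n h<t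
  with l , refl ← m≤n⇒∃[o]o+m≡n t≤n
  with refl ← +-cancelʳ-≡ (suc h) (l + g) b
         (trans (+-assoc l g (suc h)) (trans n≡ (sym (+-suc b h))))
  rewrite +-suc g h =
  A , dominating , ∣A∣
  where
  lhs : ∀ l g h → (l + suc (g + h)) * suc h ≡ suc (g + h) * suc h + l * suc h
  lhs = solve-∀
  rhs : ∀ g h → suc (g + h) * suc (2 * h) ≡ suc (g + h) * suc h + suc (g + h) * h
  rhs = solve-∀
  -- Subtracting t(h + 1) from both sides of n(h + 1) ≤ t(2h + 1) leaves l(h + 1) ≤ th.
  open Block l g h (+-cancelˡ-≤ (suc (g + h) * suc h) _ _ (subst₂ _≤_ (lhs l g h) (rhs g h) balance))

-- The three cases

⌈x/d⌉-upper : ∀ x d .{{_ : NonZero d}} → x ≤ ⌈ x / d ⌉ * d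
⌈x/d⌉-upper x d = +-cancelʳ-≤ (d ∸ 1) _ _ (begin
  x + (d ∸ 1)                                ≡⟨ m≡m%n+[m/n]*n (x + (d ∸ 1)) d ⟩
  (x + (d ∸ 1)) % d + ⌈ x / d ⌉ * d          ≤⟨ +-monoˡ-≤ _ (∸-monoˡ-≤ 1 (m%n<n (x + (d ∸ 1)) d)) ⟩
  d ∸ 1 + ⌈ x / d ⌉ * d                      ≡⟨ +-comm (d ∸ 1) _ ⟩
  ⌈ x / d ⌉ * d + (d ∸ 1)                    ∎)
  where open ≤-Reasoning

⌈x/d⌉-least : ∀ x d .{{_ : NonZero d}} u → x ≤ u * d → ⌈ x / d ⌉ ≤ u
⌈x/d⌉-least x d@(suc e) u x≤ud = ≤-pred (m<n*o⇒m/o<n (begin-strict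
  x + e            ≤⟨ +-monoˡ-≤ e x≤ud ⟩
  u * d + e        <⟨ +-monoʳ-< (u * d) ≤-refl ⟩
  u * d + d        ≡⟨ +-comm (u * d) d ⟩
  suc u * d        ∎))
  where open ≤-Reasoning

-- Since s is an integer, s - x is one of the u with y ≤ ud; `least` thus lets t act as the
-- rounded-up quotient.
quotient-bound : ∀ d .{{_ : NonZero d}} x {y t s} → (∀ u → y ≤ u * d → t ≤ u) →
                 d * x + y ≤ d * s → x + t ≤ s
quotient-bound d x {y} {t} {s} least dx+y≤ds
  with u , refl ← m≤n⇒∃[o]m+o≡n (*-cancelˡ-≤ {x} {s} d (m+n≤o⇒m≤o (d * x) dx+y≤ds)) =
  +-monoʳ-≤ x (least u (begin
    y        ≤⟨ +-cancelˡ-≤ (d * x) y (d * u) (≤-trans dx+y≤ds (≤-reflexive (*-distribˡ-+ d x u))) ⟩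
    d * u    ≡⟨ *-comm d u ⟩
    u * d    ∎))
  where open ≤-Reasoning

γ-even : b < n → 1 ≤ b + b → Isγ (T (b + b)) n n (b * n)
γ-even {b} {n} b<n 1≤a with A , dom , ∣A∣≡ ← even-construction {b} {n} (<⇒≤ b<n) (≤-trans (s≤s z≤n) b<n) =
  γ-intro 1≤a A dom ∣A∣≡ (even-bound b<n)

-- The choice t = h + 1 = n - b makes l = b and g = 0. The balance condition then reads n ≤ 2h + 1,
-- which is a ≤ n.
γ-small-odd : n ≡ suc b + h → b + suc b ≤ n → Isγ (T (b + suc b)) n n (suc b * n ∸ b)
γ-small-odd {n} {b} {h} n≡ a≤n =
  let A , dom , ∣A∣≡ = odd-construction {n} {b} {h} n≡ ≤-refl 1+h≤n balance in
  γ-intro (≤-trans (s≤s z≤n) (m≤n+m (suc b) b)) A dom (trans ∣A∣≡ (sym value))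
    (λ B dom′ → m≤n+o⇒m∸n≤o (suc b * n) b
      (≤-trans (small-odd-bound a≤n B dom′) (≤-reflexive (+-comm ∣ B ∣ b))))
  where
  n≡′ : n ≡ b + suc h
  n≡′ = trans n≡ (sym (+-suc b h))
  1+h≤n : suc h ≤ n
  1+h≤n = subst (suc h ≤_) (sym n≡′) (m≤n+m (suc h) b)
  b≤h : b ≤ h
  b≤h = ≤-pred (+-cancelˡ-≤ b _ _ (subst (b + suc b ≤_) n≡′ a≤n))
  balance : n * suc h ≤ suc h * suc (2 * h)
  balance = begin
    n * suc h                ≡⟨ *-comm n (suc h) ⟩
    suc h * n                ≡⟨ cong (suc h *_) n≡ ⟩
    suc h * suc (b + h)      ≤⟨ *-monoʳ-≤ (suc h) (s≤s (+-monoˡ-≤ h b≤h)) ⟩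
    suc h * suc (h + h)      ≡⟨ cong (λ x → suc h * suc (h + x)) (+-identityʳ h) ⟨
    suc h * suc (2 * h)      ∎
    where open ≤-Reasoning
  value : suc b * n ∸ b ≡ b * n + suc h
  value = begin
    n + b * n ∸ b              ≡⟨ cong (λ x → x + b * n ∸ b) n≡′ ⟩
    b + suc h + b * n ∸ b      ≡⟨ cong (_∸ b) (+-assoc b (suc h) (b * n)) ⟩
    b + (suc h + b * n) ∸ b    ≡⟨ m+n∸m≡n b _ ⟩
    suc h + b * n              ≡⟨ +-comm (suc h) (b * n) ⟩
    b * n + suc h              ∎
    where open ≡-Reasoning

-- The two hypotheses on t characterize the ceiling of x/d. Halving both terms turns this fraction
-- into n(h + 1)/(2h + 1), which serves both the balance condition and `odd-bound`.
γ-large-odd : ∀ {t} → n ≡ suc b + h → n < b + suc b →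
  let x = n * (suc (2 * h) + 1); d = 2 * suc (2 * h) in
  x ≤ t * d → (∀ u → x ≤ u * d → t ≤ u) → Isγ (T (b + suc b)) n n (b * n + t)
γ-large-odd {n} {b} {h} {t} refl n<a upper least =
  let A , dom , ∣A∣≡ = odd-construction {n} {b} {h} refl h<t t≤n balance in
  γ-intro (≤-trans (s≤s z≤n) (m≤n+m (suc b) b)) A dom ∣A∣≡ λ B dom′ →
    quotient-bound (suc (2 * h)) (b * n) least′ (odd-bound B dom′)
  where
  open ≤-Reasoning
  halve : ∀ n h → n * (suc (2 * h) + 1) ≡ 2 * (n * suc h)
  halve = solve-∀
  halve′ : ∀ t h → t * (2 * suc (2 * h)) ≡ 2 * (t * suc (2 * h))
  halve′ = solve-∀

  balance : n * suc h ≤ t * suc (2 * h)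
  balance = *-cancelˡ-≤ 2 (subst₂ _≤_ (halve n h) (halve′ t h) upper)

  least′ : ∀ u → n * suc h ≤ u * suc (2 * h) → t ≤ u
  least′ u le = least u (subst₂ _≤_ (sym (halve n h)) (sym (halve′ u h)) (*-monoʳ-≤ 2 le))

  t≤n : t ≤ n
  t≤n = least′ n (*-monoʳ-≤ n (s≤s (m≤m+n h _)))

  h<b : h < b
  h<b = +-cancelˡ-< b _ _ (≤-pred (subst (n <_) (+-suc b b) n<a))

  h<t : h < t
  -- Here n < a enters through h < b: it gives n ≥ 2h + 1, so t ≤ h would make t(2h + 1) smaller
  -- than n(h + 1).
  h<t = ≰⇒> λ t≤h → <⇒≱ (begin-strict
    t * suc (2 * h)        ≤⟨ *-mono-≤ t≤h (≤-reflexive (cong (λ x → suc (h + x)) (+-identityʳ h))) ⟩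
    h * suc (h + h)        <⟨ *-monoˡ-< (suc (h + h)) (n<1+n h) ⟩
    suc h * suc (h + h)    ≤⟨ *-monoʳ-≤ (suc h) (s≤s (+-monoˡ-≤ h (<⇒≤ h<b))) ⟩
    suc h * n              ≡⟨ *-comm (suc h) n ⟩
    n * suc h              ∎) balance

m*2≡m+m : ∀ m → m * 2 ≡ m + m
m*2≡m+m = solve-∀

odd-form : ∀ a → 2 ∤ a → ∃[ b ] a ≡ b + suc b
odd-form zero          2∤a = contradiction (divides-refl 0) 2∤a
odd-form (suc zero)    2∤a = 0 , refl
odd-form (suc (suc a)) 2∤a with b , refl ← odd-form a (2∤a ∘ ∣m∣n⇒∣m+n ∣-refl) =
  suc b , cong suc (sym (+-suc b (suc b)))

half-bound : 1 ≤ n → b + b ≤ 2 * n ∸ 2 → b < n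
half-bound {suc n} {b} _ 2b≤ = s≤s (*-cancelˡ-≤ 2 (begin
  2 * b             ≡⟨ cong (b +_) (+-identityʳ b) ⟩
  b + b             ≤⟨ 2b≤ ⟩
  2 * suc n ∸ 2     ≡⟨ *-distribˡ-∸ 2 (suc n) 1 ⟨
  2 * n             ∎))
  where open ≤-Reasoning

theorem1p3 : (n a : ℕ) (2≤n : 2 ≤ n) → 1 ≤ a → (a≤2n-2 : a ≤ 2 * n ∸ 2) →
    (2 ∣ a → Isγ (T a) n n ((a * n) / 2))
    × (2 ∤ a → a ≤ n → Isγ (T a) n n (((a + 1) / 2) * n ∸ (a ∸ 1) / 2))
    × (2 ∤ a → n < a → Isγ (T a) n n (((a ∸ 1) / 2) * n + ⌈_/_⌉ (n * (2 * n ∸ a + 1)) (2 * (2 * n ∸ a)) {{denominator≢0 2≤n a≤2n-2}}))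
theorem1p3 n a 2≤n 1≤a a≤2n-2 = even-case , small-odd-case , large-odd-case
  where
  1≤n : 1 ≤ n
  1≤n = <⇒≤ 2≤n

  even-case : 2 ∣ a → Isγ (T a) n n ((a * n) / 2)
  even-case (divides-refl b) =
    subst₂ (λ a k → Isγ (T a) n n k) (sym (m*2≡m+m b)) (sym value)
      (γ-even {b} (half-bound 1≤n (subst (_≤ 2 * n ∸ 2) (m*2≡m+m b) a≤2n-2))
              (subst (1 ≤_) (m*2≡m+m b) 1≤a))
    where
    swap-factors : ∀ b n → b * 2 * n ≡ b * n * 2
    swap-factors = solve-∀
    value : b * 2 * n / 2 ≡ b * n
    value = trans (/-congˡ (swap-factors b n)) (m*n/n≡m (b * n) 2)

  [a+1]/2 : ∀ b → (b + suc b + 1) / 2 ≡ suc b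
  [a+1]/2 b = trans (/-congˡ (double b)) (m*n/n≡m (suc b) 2)
    where
    double : ∀ b → b + suc b + 1 ≡ suc b * 2
    double = solve-∀

  [a∸1]/2 : ∀ b → (b + suc b ∸ 1) / 2 ≡ b
  [a∸1]/2 b = trans (/-congˡ (trans (cong (_∸ 1) (+-suc b b)) (sym (m*2≡m+m b)))) (m*n/n≡m b 2)

  -- With h = n - b - 1 the quantity 2n - a becomes 2h + 1.
  complement : ∀ b → a ≡ b + suc b → ∃[ h ] n ≡ suc b + h
  complement b a≡ with h , eq ← m≤n⇒∃[o]m+o≡n (half-bound {b = b} 1≤n
    (≤-trans (+-monoʳ-≤ b (n≤1+n b)) (subst (_≤ 2 * n ∸ 2) a≡ a≤2n-2))) = h , sym eq

  small-odd-case : 2 ∤ a → a ≤ n → Isγ (T a) n n (((a + 1) / 2) * n ∸ (a ∸ 1) / 2)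
  small-odd-case 2∤a a≤n
    with b , a≡ ← odd-form a 2∤a
    with h , n≡ ← complement b a≡
    with refl ← a≡ =
    subst (Isγ (T a) n n) (sym (cong₂ (λ x y → x * n ∸ y) ([a+1]/2 b) ([a∸1]/2 b)))
      (γ-small-odd n≡ a≤n)

  large-odd-case : 2 ∤ a → n < a → Isγ (T a) n n (((a ∸ 1) / 2) * n + ⌈_/_⌉ (n * (2 * n ∸ a + 1)) (2 * (2 * n ∸ a)) {{denominator≢0 2≤n a≤2n-2}})
  large-odd-case 2∤a n<a
    with b , a≡ ← odd-form a 2∤a
    with h , n≡ ← complement b a≡
    with refl ← a≡ =
    subst (λ x → Isγ (T a) n n (x * n + t)) (sym ([a∸1]/2 b))
      (γ-large-odd n≡ n<a
        (subst (λ d → n * (d + 1) ≤ t * (2 * d)) 2n∸a≡ (⌈x/d⌉-upper x d))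
        (λ u → ⌈x/d⌉-least x d u ∘ subst (λ d → n * (d + 1) ≤ u * (2 * d)) (sym 2n∸a≡)))
    where
    x = n * (2 * n ∸ a + 1)
    d = 2 * (2 * n ∸ a)
    instance
      d≢0 : NonZero d
      d≢0 = denominator≢0 2≤n a≤2n-2
    t = ⌈ x / d ⌉
    2n≡ : ∀ b h → 2 * (suc b + h) ≡ suc (2 * h) + (b + suc b)
    2n≡ = solve-∀
    2n∸a≡ : 2 * n ∸ (b + suc b) ≡ suc (2 * h)
    2n∸a≡ = trans (cong (λ n → 2 * n ∸ (b + suc b)) n≡)
      (trans (cong (_∸ (b + suc b)) (2n≡ b h)) (m+n∸n≡m (suc (2 * h)) (b + suc b)))
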